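{- Let $f(x)\in\mathbb{Z}[x]$ be monic with $\deg f(x)=m$, suppose that at least one of the (complex) roots of $f(x)$ is not an integer, and let $q_1,q_2,\dots,q_m\in\mathbb{Z}$. Then the equation $$(y+q_1)(y+q_2)\cdots(y+q_m)=f(x)$$ has finitely many solutions $(x,y)$ in integers. -}

module Defs where

open import Level using (0ℓ; _⊔_)
open import Function.Base using (id; const)
open import Function.Bundles using (_⇔_)
open import Data.Nat.Base as ℕ using (ℕ; zero; suc)
import Data.Nat.Properties as ℕ
open import Data.Integer.Base as ℤ using (ℤ)
open import Data.Rational.Base as ℚ using (ℚ; 0ℚ; 1ℚ; ½; ∣_∣)
import Data.Rational.Properties as ℚ
open import Data.Rational.Solver using (module +-*-Solver)
open import Data.List.Base using (List; []; _∷_)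
open import Data.List.Membership.Propositional using (_∈_)
open import Data.Fin.Base using (Fin)
open import Data.Vec.Functional using (Vector; foldr)
open import Data.Product.Base using (Σ; ∃; _×_; _,_; proj₁; proj₂)
open import Relation.Nullary.Negation.Core using (¬_)
open import Relation.Unary using (Pred)
open import Relation.Binary.PropositionalEquality
  using (_≡_; refl; sym; trans; cong; cong₂; subst)
open import Algebra.Bundles.Raw using (RawRing)

Finite : ∀ {a p} {A : Set a} → Pred A p → Set (a ⊔ p)
Finite {A = A} P = ∃ λ (xs : List A) → ∀ x → P x ⇔ x ∈ xs

∏ : ∀ {n} → Vector ℤ n → ℤ
∏ = foldr ℤ._*_ ℤ.1ℤ

-- Lists of coefficients, constant term first;
-- trailing zeros are allowed.
ℤ[x] : Set
ℤ[x] = List ℤ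

coeff : ℤ[x] → ℕ → ℤ
coeff []      k       = ℤ.0ℤ
coeff (a ∷ f) zero    = a
coeff (a ∷ f) (suc k) = coeff f k

MonicOfDegree : ℕ → ℤ[x] → Set
MonicOfDegree m f =
  coeff f m ≡ ℤ.1ℤ × (∀ k → m ℕ.< k → coeff f k ≡ ℤ.0ℤ)

module Eval {c ℓ} (R : RawRing c ℓ) (ι : ℤ → RawRing.Carrier R) where
  open RawRing R

  eval : ℤ[x] → Carrier → Carrier
  eval []      z = 0#
  eval (a ∷ f) z = ι a + z * eval f z

evalℤ : ℤ[x] → ℤ → ℤ
evalℤ = Eval.eval ℤ.+-*-rawRing id

Cauchy : (ℕ → ℚ) → Set
Cauchy u = ∀ ε → 0ℚ ℚ.< ε →
  ∃ λ N → ∀ m n → N ℕ.≤ m → N ℕ.≤ n → ∣ u m ℚ.- u n ∣ ℚ.< ε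

abstract
  0<ε⇒0<½ε : ∀ {ε} → 0ℚ ℚ.< ε → 0ℚ ℚ.< ½ ℚ.* ε
  0<ε⇒0<½ε {ε} 0<ε =
    ℚ.positive⁻¹ (½ ℚ.* ε) {{ℚ.pos*pos⇒pos ½ ε {{ℚ.positive 0<ε}}}}

  ½ε+½ε≡ε : ∀ ε → ½ ℚ.* ε ℚ.+ ½ ℚ.* ε ≡ ε
  ½ε+½ε≡ε ε = trans (sym (ℚ.*-distribʳ-+ ε ½ ½)) (ℚ.*-identityˡ ε)

  cauchy-const : ∀ p → Cauchy (const p)
  cauchy-const p ε 0<ε =
    0 , λ _ _ _ _ → subst (λ d → ∣ d ∣ ℚ.< ε) (sym (ℚ.+-inverseʳ p)) 0<ε

  cauchy-+ : ∀ {u v} → Cauchy u → Cauchy v → Cauchy (λ n → u n ℚ.+ v n)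
  cauchy-+ {u} {v} cu cv ε 0<ε
    with cu (½ ℚ.* ε) (0<ε⇒0<½ε 0<ε) | cv (½ ℚ.* ε) (0<ε⇒0<½ε 0<ε)
  ... | M , hu | N , hv = M ℕ.⊔ N , λ m n p q → begin-strict
    ∣ (u m ℚ.+ v m) ℚ.- (u n ℚ.+ v n) ∣
      ≡⟨ cong ∣_∣ (rearrange (u m) (v m) (u n) (v n)) ⟩
    ∣ (u m ℚ.- u n) ℚ.+ (v m ℚ.- v n) ∣
      ≤⟨ ℚ.∣p+q∣≤∣p∣+∣q∣ (u m ℚ.- u n) (v m ℚ.- v n) ⟩
    ∣ u m ℚ.- u n ∣ ℚ.+ ∣ v m ℚ.- v n ∣
      <⟨ ℚ.+-mono-< (hu m n (ℕ.m⊔n≤o⇒m≤o M N p) (ℕ.m⊔n≤o⇒m≤o M N q))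
                    (hv m n (ℕ.m⊔n≤o⇒n≤o M N p) (ℕ.m⊔n≤o⇒n≤o M N q)) ⟩
    ½ ℚ.* ε ℚ.+ ½ ℚ.* ε
      ≡⟨ ½ε+½ε≡ε ε ⟩
    ε ∎
    where
    open ℚ.≤-Reasoning
    rearrange : ∀ a b c d →
      (a ℚ.+ b) ℚ.- (c ℚ.+ d) ≡ (a ℚ.- c) ℚ.+ (b ℚ.- d)
    rearrange = solve 4 (λ a b c d →
      (a :+ b) :- (c :+ d) := (a :- c) :+ (b :- d)) refl
      where open +-*-Solver

  cauchy-neg : ∀ {u} → Cauchy u → Cauchy (λ n → ℚ.- u n)
  cauchy-neg {u} cu ε 0<ε with cu ε 0<ε
  ... | N , hu = N , λ m n p q →
    subst (ℚ._< ε)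
      (trans (sym (ℚ.∣-p∣≡∣p∣ (u m ℚ.- u n)))
             (cong ∣_∣ (ℚ.neg-distrib-+ (u m) (ℚ.- u n))))
      (hu m n p q)

  cauchy-bounded : ∀ {u} → Cauchy u → ∃ λ B → ℚ.Positive B ×
    ∃ λ N → ∀ n → N ℕ.≤ n → ∣ u n ∣ ℚ.≤ B
  cauchy-bounded {u} cu with cu 1ℚ (ℚ.positive⁻¹ 1ℚ)
  ... | N , hu = ∣ u N ∣ ℚ.+ 1ℚ
               , ℚ.nonNeg+pos⇒pos ∣ u N ∣ {{ℚ.nonNegative (ℚ.0≤∣p∣ (u N))}} 1ℚ
               , N , λ n p → begin
    ∣ u n ∣                          ≡⟨ cong ∣_∣ (split (u n) (u N)) ⟩
    ∣ u N ℚ.+ (u n ℚ.- u N) ∣        ≤⟨ ℚ.∣p+q∣≤∣p∣+∣q∣ (u N) (u n ℚ.- u N) ⟩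
    ∣ u N ∣ ℚ.+ ∣ u n ℚ.- u N ∣      ≤⟨ ℚ.+-monoʳ-≤ ∣ u N ∣ (ℚ.<⇒≤ (hu n N p ℕ.≤-refl)) ⟩
    ∣ u N ∣ ℚ.+ 1ℚ                   ∎
    where
    open ℚ.≤-Reasoning
    split : ∀ a b → a ≡ b ℚ.+ (a ℚ.- b)
    split = solve 2 (λ a b → a := b :+ (a :- b)) refl
      where open +-*-Solver

  tolerance : ∀ B → ℚ.Positive B → ∀ ε → 0ℚ ℚ.< ε → ∃ λ δ → 0ℚ ℚ.< δ ×
    (∀ {a d} → ∣ a ∣ ℚ.≤ B → ∣ d ∣ ℚ.< δ → ∣ a ℚ.* d ∣ ℚ.< ε)
  tolerance B B>0 ε 0<ε = δ , ℚ.positive⁻¹ δ , bound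
    where
    open ℚ.≤-Reasoning
    instance
      B-positive : ℚ.Positive B
      B-positive = B>0
      B-nonZero : ℚ.NonZero B
      B-nonZero = ℚ.pos⇒nonZero B
      ε-positive : ℚ.Positive ε
      ε-positive = ℚ.positive 0<ε
      B⁻¹-positive : ℚ.Positive (ℚ.1/ B)
      B⁻¹-positive = ℚ.1/pos⇒pos B
      B⁻¹ε-positive : ℚ.Positive (ℚ.1/ B ℚ.* ε)
      B⁻¹ε-positive = ℚ.pos*pos⇒pos (ℚ.1/ B) ε
    δ : ℚ
    δ = ℚ.1/ B ℚ.* ε
    bound : ∀ {a d} → ∣ a ∣ ℚ.≤ B → ∣ d ∣ ℚ.< δ → ∣ a ℚ.* d ∣ ℚ.< ε
    bound {a} {d} a≤B d<δ = begin-strict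
      ∣ a ℚ.* d ∣              ≡⟨ ℚ.∣p*q∣≡∣p∣*∣q∣ a d ⟩
      ∣ a ∣ ℚ.* ∣ d ∣          ≤⟨ ℚ.*-monoʳ-≤-nonNeg ∣ d ∣ {{ℚ.nonNegative (ℚ.0≤∣p∣ d)}} a≤B ⟩
      B ℚ.* ∣ d ∣              <⟨ ℚ.*-monoʳ-<-pos B d<δ ⟩
      B ℚ.* (ℚ.1/ B ℚ.* ε)     ≡⟨ sym (ℚ.*-assoc B (ℚ.1/ B) ε) ⟩
      (B ℚ.* ℚ.1/ B) ℚ.* ε     ≡⟨ cong (ℚ._* ε) (ℚ.*-inverseʳ B) ⟩
      1ℚ ℚ.* ε                 ≡⟨ ℚ.*-identityˡ ε ⟩
      ε                        ∎

  product-close : ∀ {a b c d ε} →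
    ∣ a ℚ.* (b ℚ.- d) ∣ ℚ.< ½ ℚ.* ε → ∣ d ℚ.* (a ℚ.- c) ∣ ℚ.< ½ ℚ.* ε →
    ∣ a ℚ.* b ℚ.- c ℚ.* d ∣ ℚ.< ε
  product-close {a} {b} {c} {d} {ε} h k = begin-strict
    ∣ a ℚ.* b ℚ.- c ℚ.* d ∣
      ≡⟨ cong ∣_∣ (insert (a ℚ.* b) (a ℚ.* d) (c ℚ.* d)) ⟩
    ∣ (a ℚ.* b ℚ.- a ℚ.* d) ℚ.+ (a ℚ.* d ℚ.- c ℚ.* d) ∣
      ≡⟨ cong ∣_∣ (cong₂ ℚ._+_ (sym (x[y-z]≈xy-xz a b d)) (sym ([y-z]x≈yx-zx d a c))) ⟩
    ∣ a ℚ.* (b ℚ.- d) ℚ.+ (a ℚ.- c) ℚ.* d ∣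
      ≡⟨ cong (λ t → ∣ a ℚ.* (b ℚ.- d) ℚ.+ t ∣) (ℚ.*-comm (a ℚ.- c) d) ⟩
    ∣ a ℚ.* (b ℚ.- d) ℚ.+ d ℚ.* (a ℚ.- c) ∣
      ≤⟨ ℚ.∣p+q∣≤∣p∣+∣q∣ (a ℚ.* (b ℚ.- d)) (d ℚ.* (a ℚ.- c)) ⟩
    ∣ a ℚ.* (b ℚ.- d) ∣ ℚ.+ ∣ d ℚ.* (a ℚ.- c) ∣
      <⟨ ℚ.+-mono-< h k ⟩
    ½ ℚ.* ε ℚ.+ ½ ℚ.* ε
      ≡⟨ ½ε+½ε≡ε ε ⟩
    ε ∎
    where
    open ℚ.≤-Reasoning
    open import Algebra.Properties.Ring ℚ.+-*-ring
      using (x[y-z]≈xy-xz; [y-z]x≈yx-zx)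
    insert : ∀ x y z → x ℚ.- z ≡ (x ℚ.- y) ℚ.+ (y ℚ.- z)
    insert = solve 3 (λ x y z → x :- z := (x :- y) :+ (y :- z)) refl
      where open +-*-Solver

  cauchy-* : ∀ {u v} → Cauchy u → Cauchy v → Cauchy (λ n → u n ℚ.* v n)
  cauchy-* {u} {v} cu cv ε 0<ε =
    let A , A>0 , K , u≤A = cauchy-bounded {u} cu
        B , B>0 , L , v≤B = cauchy-bounded {v} cv
        δ , 0<δ , hA = tolerance A A>0 (½ ℚ.* ε) (0<ε⇒0<½ε {ε} 0<ε)
        η , 0<η , hB = tolerance B B>0 (½ ℚ.* ε) (0<ε⇒0<½ε {ε} 0<ε)
        M , hu = cu η 0<η
        N , hv = cv δ 0<δ
    in (K ℕ.⊔ L) ℕ.⊔ (M ℕ.⊔ N) , λ m n p q →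
    let pKL = ℕ.m⊔n≤o⇒m≤o (K ℕ.⊔ L) (M ℕ.⊔ N) p
        qKL = ℕ.m⊔n≤o⇒m≤o (K ℕ.⊔ L) (M ℕ.⊔ N) q
        pMN = ℕ.m⊔n≤o⇒n≤o (K ℕ.⊔ L) (M ℕ.⊔ N) p
        qMN = ℕ.m⊔n≤o⇒n≤o (K ℕ.⊔ L) (M ℕ.⊔ N) q
    in product-close {u m} {v m} {u n} {v n} {ε}
         (hA {u m} {v m ℚ.- v n} (u≤A m (ℕ.m⊔n≤o⇒m≤o K L pKL))
             (hv m n (ℕ.m⊔n≤o⇒n≤o M N pMN) (ℕ.m⊔n≤o⇒n≤o M N qMN)))
         (hB {v n} {u m ℚ.- u n} (v≤B n (ℕ.m⊔n≤o⇒n≤o K L qKL))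
             (hu m n (ℕ.m⊔n≤o⇒m≤o M N pMN) (ℕ.m⊔n≤o⇒m≤o M N qMN)))

-- Cauchy sequences of rationals with termwise operations;
-- two of them are equal when their difference tends to 0.
record ℝ : Set where
  constructor mkℝ
  field
    seq    : ℕ → ℚ
    cauchy : Cauchy seq

open ℝ public

infix 4 _≈ℝ_

_≈ℝ_ : ℝ → ℝ → Set
x ≈ℝ y = ∀ ε → 0ℚ ℚ.< ε →
  ∃ λ N → ∀ n → N ℕ.≤ n → ∣ seq x n ℚ.- seq y n ∣ ℚ.< ε

fromℚ : ℚ → ℝ
fromℚ p = mkℝ (const p) (cauchy-const p)

infixl 6 _+ℝ_
infixl 7 _*ℝ_

_+ℝ_ : ℝ → ℝ → ℝ
x +ℝ y = mkℝ (λ n → seq x n ℚ.+ seq y n) (cauchy-+ {seq x} {seq y} (cauchy x) (cauchy y))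

-ℝ_ : ℝ → ℝ
-ℝ x = mkℝ (λ n → ℚ.- seq x n) (cauchy-neg {seq x} (cauchy x))

_*ℝ_ : ℝ → ℝ → ℝ
x *ℝ y = mkℝ (λ n → seq x n ℚ.* seq y n) (cauchy-* {seq x} {seq y} (cauchy x) (cauchy y))

record ℂ : Set where
  constructor _+i_
  field
    re im : ℝ

open ℂ public

infix 4 _≈ℂ_

_≈ℂ_ : ℂ → ℂ → Set
z ≈ℂ w = re z ≈ℝ re w × im z ≈ℝ im w

fromℤ : ℤ → ℂ
fromℤ k = fromℚ (k ℚ./ 1) +i fromℚ 0ℚ

ℂ-rawRing : RawRing 0ℓ 0ℓ
ℂ-rawRing = record
  { Carrier = ℂ
  ; _≈_     = _≈ℂ_
  ; _+_     = λ z w → (re z +ℝ re w) +i (im z +ℝ im w)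
  ; _*_     = λ z w → ((re z *ℝ re w) +ℝ (-ℝ (im z *ℝ im w)))
                   +i ((re z *ℝ im w) +ℝ (im z *ℝ re w))
  ; -_      = λ z → (-ℝ re z) +i (-ℝ im z)
  ; 0#      = fromℤ ℤ.0ℤ
  ; 1#      = fromℤ ℤ.1ℤ
  }

evalℂ : ℤ[x] → ℂ → ℂ
evalℂ = Eval.eval ℂ-rawRing fromℤ

IsRoot : ℤ[x] → ℂ → Set
IsRoot f z = evalℂ f z ≈ℂ fromℤ ℤ.0ℤ

IsInteger : ℂ → Set
IsInteger z = ∃ λ (k : ℤ) → z ≈ℂ fromℤ k

{-# OPTIONS --safe #-}

-- Write P(y) = ∏ (y + qᵢ).  Both P and f are monic of degree m, so a solution
-- has ∣ ∣x∣ − ∣y∣ ∣ ≤ K for a constant K: it lies on one of the finitely many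
-- lines y = ±x + c with ∣c∣ ≤ K.  On each line x is a root of P(±x + c) − f(x).
-- If that polynomial were zero, f would be a product of linear factors
-- ±(x − k) with k ∈ ℤ, and a complex root of f would be an integer; so it is
-- nonzero and its integer roots are bounded by its lowest nonzero coefficient.
-- Vanishing of coefficients is transferred to ℂ through the Gaussian rationals
-- z_n that form the Cauchy sequence of z, where exact ring identities hold.

module Submission where

open import Defs
open import Level using (Level; 0ℓ)
open import Algebra.Bundles using (AbelianGroup; CommutativeRing)
open import Algebra.Bundles.Raw using (RawRing)
import Algebra.Construct.DirectProduct as DirectProduct
open import Algebra.Morphism.Construct.Identity using (isSemiringHomomorphism)
open import Algebra.Morphism.Structures using (module SemiringMorphisms)
open import Data.Fin.Base as Fin using (Fin)
open import Data.Integer.Base as ℤ using (ℤ; _+_; _◃_; ∣_∣)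
import Data.Integer.Properties as ℤ
import Data.Integer.Solver as ℤ
open import Data.List.Base using (List; []; _∷_; map; upTo; _++_; filter; cartesianProduct)
open import Data.List.Extrema.Nat using (max; xs≤max)
open import Data.List.Membership.Propositional using (_∈_)
open import Data.List.Membership.Propositional.Properties
  using (∈-map⁺; ∈-++⁺ˡ; ∈-++⁺ʳ; ∈-upTo⁺; ∈-filter⁺; ∈-filter⁻; ∈-cartesianProduct⁺)
import Data.List.Relation.Unary.All as All
open import Data.List.Relation.Unary.Any using (here; there)
open import Data.Nat.Base as ℕ using (ℕ; zero; suc; NonZero)
import Data.Nat.Properties as ℕ
open import Data.Product.Base using (∃; _×_; _,_; proj₁; proj₂)
open import Data.Rational.Base as ℚ using (ℚ; 0ℚ; 1ℚ; ½)
import Data.Rational.Properties as ℚ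
import Data.Rational.Solver as ℚ
open import Data.Rational.Unnormalised.Base as ℚᵘ using (mkℚᵘ)
import Data.Rational.Unnormalised.Properties as ℚᵘ
open import Data.Sign.Base as Sign using (Sign)
open import Data.Sum.Base using (_⊎_; inj₁; inj₂)
open import Data.Vec.Functional using (Vector; foldr; head; tail)
open import Function.Base using (id; _∘_)
open import Function.Bundles using (mk⇔)
open import Relation.Binary.PropositionalEquality
  using (_≡_; refl; sym; trans; cong; cong₂; subst; module ≡-Reasoning)
open import Relation.Nullary.Decidable.Core using (Dec; yes; no)
open import Relation.Nullary.Negation.Core using (¬_; contradiction)
open import Relation.Unary using (Pred; Decidable)

-- Growth of monic polynomials and of products of shifts.

∣j∣≤∣i+j∣+∣i∣ : ∀ i j → ∣ j ∣ ℕ.≤ ∣ i + j ∣ ℕ.+ ∣ i ∣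
∣j∣≤∣i+j∣+∣i∣ i j = begin
  ∣ j ∣                    ≡⟨ cong ∣_∣ (xyx⁻¹≈y i j) ⟨
  ∣ (i + j) ℤ.- i ∣        ≤⟨ ℤ.∣i-j∣≤∣i∣+∣j∣ (i + j) i ⟩
  ∣ i + j ∣ ℕ.+ ∣ i ∣      ∎
  where
  open ℕ.≤-Reasoning
  open import Algebra.Properties.AbelianGroup ℤ.+-0-abelianGroup using (xyx⁻¹≈y)

-- Encodes (∣x∣ - A)^m ≤ ∣h x∣ ≤ (∣x∣ + A)^m. The lower half is phrased through `D` in place of the
-- truncated difference ∣x∣ - A, and `D` is positive so that its powers are at least 1.
Growth : ℕ → (ℤ → ℤ) → Set
Growth m h = ∃ λ A → ∀ x →
  ∣ h x ∣ ℕ.≤ (∣ x ∣ ℕ.+ A) ℕ.^ m ×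
  (∀ D .{{_ : NonZero D}} → D ℕ.+ A ℕ.≤ ∣ x ∣ → D ℕ.^ m ℕ.≤ ∣ h x ∣)

growth-one : ∀ {h} → (∀ x → h x ≡ ℤ.1ℤ) → Growth 0 h
growth-one h≡1 = 0 , λ x →
  ℕ.≤-reflexive (cong ∣_∣ (h≡1 x)) , λ _ _ → ℕ.≤-reflexive (cong ∣_∣ (sym (h≡1 x)))

-- In both halves the constant term is absorbed by ∣a∣ ≤ ∣a∣ * E, where the power `E` is at least 1;
-- it then only shifts the base by ∣a∣. For the lower half ∣a∣ is first added to both sides.
growth-horner : ∀ {m h} a → Growth m h → Growth (suc m) (λ x → a + x ℤ.* h x)
growth-horner {m} {h} a (A , bounds) = A′ , λ x → upper x , lower x
  where
  open ℕ.≤-Reasoning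
  A′ : ℕ
  -- The `suc` keeps ∣x∣ + A′ positive even at x = 0, which gives `E` ≥ 1 in the upper half.
  A′ = suc (∣ a ∣ ℕ.+ A)

  A≤A′ : A ℕ.≤ A′
  A≤A′ = ℕ.m≤n⇒m≤1+n (ℕ.m≤n+m A ∣ a ∣)

  a≤A′ : ∣ a ∣ ℕ.≤ A′
  a≤A′ = ℕ.m≤n⇒m≤1+n (ℕ.m≤m+n ∣ a ∣ A)

  upper : ∀ x → ∣ a + x ℤ.* h x ∣ ℕ.≤ (∣ x ∣ ℕ.+ A′) ℕ.^ suc m
  upper x = begin
    ∣ a + x ℤ.* h x ∣              ≤⟨ ℤ.∣i+j∣≤∣i∣+∣j∣ a (x ℤ.* h x) ⟩
    ∣ a ∣ ℕ.+ ∣ x ℤ.* h x ∣        ≡⟨ cong (∣ a ∣ ℕ.+_) (ℤ.abs-* x (h x)) ⟩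
    ∣ a ∣ ℕ.+ ∣ x ∣ ℕ.* ∣ h x ∣    ≤⟨ ℕ.+-mono-≤ (ℕ.m≤m*n ∣ a ∣ E) (ℕ.*-monoʳ-≤ ∣ x ∣ hx≤E) ⟩
    ∣ a ∣ ℕ.* E ℕ.+ ∣ x ∣ ℕ.* E    ≡⟨ ℕ.*-distribʳ-+ E ∣ a ∣ ∣ x ∣ ⟨
    (∣ a ∣ ℕ.+ ∣ x ∣) ℕ.* E        ≤⟨ ℕ.*-monoˡ-≤ E (ℕ.+-monoˡ-≤ ∣ x ∣ a≤A′) ⟩
    (A′ ℕ.+ ∣ x ∣) ℕ.* E           ≡⟨ cong (ℕ._* E) (ℕ.+-comm A′ ∣ x ∣) ⟩
    (∣ x ∣ ℕ.+ A′) ℕ.* E           ∎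
    where
    E : ℕ
    E = (∣ x ∣ ℕ.+ A′) ℕ.^ m
    instance
      X≢0 : NonZero (∣ x ∣ ℕ.+ A′)
      X≢0 = ℕ.>-nonZero (ℕ.<-≤-trans ℕ.z<s (ℕ.m≤n+m A′ ∣ x ∣))
      E≢0 : NonZero E
      E≢0 = ℕ.m^n≢0 _ m
    hx≤E : ∣ h x ∣ ℕ.≤ E
    hx≤E = ℕ.≤-trans (proj₁ (bounds x)) (ℕ.^-monoˡ-≤ m (ℕ.+-monoʳ-≤ ∣ x ∣ A≤A′))

  lower : ∀ x D .{{_ : NonZero D}} → D ℕ.+ A′ ℕ.≤ ∣ x ∣ →
          D ℕ.^ suc m ℕ.≤ ∣ a + x ℤ.* h x ∣
  lower x D D+A′≤x = ℕ.+-cancelʳ-≤ ∣ a ∣ _ _ (begin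
    D ℕ.* E ℕ.+ ∣ a ∣              ≤⟨ ℕ.+-monoʳ-≤ (D ℕ.* E) (ℕ.m≤m*n ∣ a ∣ E) ⟩
    D ℕ.* E ℕ.+ ∣ a ∣ ℕ.* E        ≡⟨ ℕ.*-distribʳ-+ E D ∣ a ∣ ⟨
    (D ℕ.+ ∣ a ∣) ℕ.* E            ≤⟨ ℕ.*-mono-≤ (ℕ.≤-trans (ℕ.+-monoʳ-≤ D a≤A′) D+A′≤x) E≤hx ⟩
    ∣ x ∣ ℕ.* ∣ h x ∣              ≡⟨ ℤ.abs-* x (h x) ⟨
    ∣ x ℤ.* h x ∣                  ≤⟨ ∣j∣≤∣i+j∣+∣i∣ a (x ℤ.* h x) ⟩
    ∣ a + x ℤ.* h x ∣ ℕ.+ ∣ a ∣    ∎)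
    where
    E : ℕ
    E = D ℕ.^ m
    instance
      E≢0 : NonZero E
      E≢0 = ℕ.m^n≢0 D m
    E≤hx : E ℕ.≤ ∣ h x ∣
    E≤hx = proj₂ (bounds x) D (ℕ.≤-trans (ℕ.+-monoʳ-≤ D A≤A′) D+A′≤x)

growth-*-shift : ∀ {m h} q → Growth m h → Growth (suc m) (λ y → (y + q) ℤ.* h y)
growth-*-shift {m} {h} q (A , bounds) = ∣ q ∣ ℕ.+ A , λ y → upper y , lower y
  where
  open ℕ.≤-Reasoning
  A≤ : A ℕ.≤ ∣ q ∣ ℕ.+ A
  A≤ = ℕ.m≤n+m A ∣ q ∣

  q≤ : ∣ q ∣ ℕ.≤ ∣ q ∣ ℕ.+ A
  q≤ = ℕ.m≤m+n ∣ q ∣ A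

  upper : ∀ y → ∣ (y + q) ℤ.* h y ∣ ℕ.≤ (∣ y ∣ ℕ.+ (∣ q ∣ ℕ.+ A)) ℕ.^ suc m
  upper y = begin
    ∣ (y + q) ℤ.* h y ∣      ≡⟨ ℤ.abs-* (y + q) (h y) ⟩
    ∣ y + q ∣ ℕ.* ∣ h y ∣    ≤⟨ ℕ.*-mono-≤
                                  (ℕ.≤-trans (ℤ.∣i+j∣≤∣i∣+∣j∣ y q) (ℕ.+-monoʳ-≤ ∣ y ∣ q≤))
                                  (ℕ.≤-trans (proj₁ (bounds y)) (ℕ.^-monoˡ-≤ m (ℕ.+-monoʳ-≤ ∣ y ∣ A≤))) ⟩
    (∣ y ∣ ℕ.+ (∣ q ∣ ℕ.+ A)) ℕ.^ suc m ∎

  lower : ∀ y D .{{_ : NonZero D}} → D ℕ.+ (∣ q ∣ ℕ.+ A) ℕ.≤ ∣ y ∣ →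
          D ℕ.^ suc m ℕ.≤ ∣ (y + q) ℤ.* h y ∣
  lower y D D+A≤y = begin
    D ℕ.^ suc m              ≤⟨ ℕ.*-mono-≤ D≤y+q (proj₂ (bounds y) D (ℕ.≤-trans (ℕ.+-monoʳ-≤ D A≤) D+A≤y)) ⟩
    ∣ y + q ∣ ℕ.* ∣ h y ∣    ≡⟨ ℤ.abs-* (y + q) (h y) ⟨
    ∣ (y + q) ℤ.* h y ∣      ∎
    where
    D≤y+q : D ℕ.≤ ∣ y + q ∣
    D≤y+q = ℕ.+-cancelʳ-≤ ∣ q ∣ _ _ (begin
      D ℕ.+ ∣ q ∣                ≤⟨ ℕ.+-monoʳ-≤ D q≤ ⟩
      D ℕ.+ (∣ q ∣ ℕ.+ A)        ≤⟨ D+A≤y ⟩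
      ∣ y ∣                      ≤⟨ ∣j∣≤∣i+j∣+∣i∣ q y ⟩
      ∣ q + y ∣ ℕ.+ ∣ q ∣        ≡⟨ cong (λ t → ∣ t ∣ ℕ.+ ∣ q ∣) (ℤ.+-comm q y) ⟩
      ∣ y + q ∣ ℕ.+ ∣ q ∣        ∎)

growth-∏ : ∀ {m} (q : Vector ℤ m) → Growth m (λ y → ∏ (λ i → y + q i))
growth-∏ {zero}  q = growth-one (λ _ → refl)
growth-∏ {suc m} q = growth-*-shift {m} (head q) (growth-∏ (tail q))

-- If ∣x∣ exceeded ∣y∣ + B + A, then D = ∣y∣ + B + 1 would be admissible in the lower bound for `g`,
-- so D^(m+1) ≤ ∣g x∣ = ∣h y∣ ≤ (D - 1)^(m+1). The positive exponent makes the power strictly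
-- monotone, a contradiction.
growth⇒∣x∣≤∣y∣+K : ∀ {m g h} → Growth (suc m) g → Growth (suc m) h →
  ∃ λ K → ∀ x y → g x ≡ h y → ∣ x ∣ ℕ.≤ ∣ y ∣ ℕ.+ K
growth⇒∣x∣≤∣y∣+K {m} {g} {h} (A , gb) (B , hb) = B ℕ.+ A , λ x y gx≡hy →
  ℕ.≮⇒≥ λ y+K<x → ℕ.<⇒≱ (ℕ.^-monoˡ-< (suc m) (ℕ.n<1+n (∣ y ∣ ℕ.+ B))) (begin
    suc (∣ y ∣ ℕ.+ B) ℕ.^ suc m    ≤⟨ proj₂ (gb x) _
                                        (subst (ℕ._< ∣ x ∣) (sym (ℕ.+-assoc ∣ y ∣ B A)) y+K<x) ⟩
    ∣ g x ∣                        ≡⟨ cong ∣_∣ gx≡hy ⟩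
    ∣ h y ∣                        ≤⟨ proj₁ (hb y) ⟩
    (∣ y ∣ ℕ.+ B) ℕ.^ suc m        ∎)
  where open ℕ.≤-Reasoning

-- Arithmetic of coefficient lists and its compatibility with evaluation.

infixl 6 _⊕_ _⊝_

_⊕_ : ℤ[x] → ℤ[x] → ℤ[x]
[]      ⊕ g       = g
(a ∷ f) ⊕ []      = a ∷ f
(a ∷ f) ⊕ (b ∷ g) = a + b ∷ f ⊕ g

scale : ℤ → ℤ[x] → ℤ[x]
scale a = map (a ℤ.*_)

_⊝_ : ℤ[x] → ℤ[x] → ℤ[x]
f ⊝ g = f ⊕ scale ℤ.-1ℤ g

linear* : ℤ → ℤ → ℤ[x] → ℤ[x]
linear* a b g = scale a g ⊕ (ℤ.0ℤ ∷ scale b g)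

-- All factors share the slope `b`: this is the shape that ∏ (y + qᵢ) takes when y is restricted to
-- a line of slope `b`.
linearProduct : ∀ {n} → ℤ → Vector ℤ n → ℤ[x]
linearProduct b = foldr (λ a → linear* a b) (ℤ.1ℤ ∷ [])

-- Coefficientwise, because lists may carry trailing zeros: `f ⊝ f` is a list of zeros and not `[]`
-- in general.
IsZero : ℤ[x] → Set
IsZero f = ∀ k → coeff f k ≡ ℤ.0ℤ

-- Generic in the ring, so that one set of identities serves both integer solutions and the Gaussian
-- rational approximations of a complex root.
module Evaluation {c ℓ : Level} (R : CommutativeRing c ℓ)
  (ι : ℤ → CommutativeRing.Carrier R)
  (ι-homo : SemiringMorphisms.IsSemiringHomomorphism
    ℤ.+-*-rawSemiring (RawRing.rawSemiring (CommutativeRing.rawRing R)) ι) where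

  open CommutativeRing R hiding (zero; refl; sym; trans) renaming (_+_ to _+′_; _*_ to _*′_; -_ to -′_)
  module ≈ = CommutativeRing R using (refl; sym; trans)
  open SemiringMorphisms.IsSemiringHomomorphism ι-homo
  open Eval rawRing ι public
  open import Algebra.Solver.Ring.NaturalCoefficients.Default commutativeSemiring
  open import Relation.Binary.Reasoning.Setoid setoid

  ∏′ : ∀ {n} → Vector Carrier n → Carrier
  ∏′ = foldr _*′_ 1#

  eval-zero : ∀ f z → IsZero f → eval f z ≈ 0#
  eval-zero []      z f≡0 = ≈.refl
  eval-zero (a ∷ f) z f≡0 = begin
    ι a +′ z *′ eval f z    ≈⟨ +-cong (≈.trans (⟦⟧-cong (f≡0 0)) 0#-homo)
                                      (*-congˡ (eval-zero f z (f≡0 ∘ suc))) ⟩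
    0# +′ z *′ 0#           ≈⟨ solve 1 (λ z → con 0 :+ z :* con 0 := con 0) ≈.refl z ⟩
    0#                      ∎

  eval-monic-0 : ∀ f z → MonicOfDegree 0 f → eval f z ≈ 1#
  eval-monic-0 []      z (() , _)
  eval-monic-0 (a ∷ f) z (a≡1 , f≡0) = begin
    ι a +′ z *′ eval f z    ≈⟨ +-cong (≈.trans (⟦⟧-cong a≡1) 1#-homo)
                                      (*-congˡ (eval-zero f z (λ k → f≡0 (suc k) ℕ.z<s))) ⟩
    1# +′ z *′ 0#           ≈⟨ solve 1 (λ z → con 1 :+ z :* con 0 := con 1) ≈.refl z ⟩
    1#                      ∎

  eval-⊕ : ∀ f g z → eval (f ⊕ g) z ≈ eval f z +′ eval g z
  eval-⊕ []      g       z = ≈.sym (+-identityˡ (eval g z))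
  eval-⊕ (a ∷ f) []      z = ≈.sym (+-identityʳ (eval (a ∷ f) z))
  eval-⊕ (a ∷ f) (b ∷ g) z = begin
    ι (a + b) +′ z *′ eval (f ⊕ g) z
      ≈⟨ +-cong (+-homo a b) (*-congˡ (eval-⊕ f g z)) ⟩
    (ι a +′ ι b) +′ z *′ (eval f z +′ eval g z)
      ≈⟨ solve 5 (λ a b z f g → (a :+ b) :+ z :* (f :+ g) := (a :+ z :* f) :+ (b :+ z :* g))
           ≈.refl (ι a) (ι b) z (eval f z) (eval g z) ⟩
    (ι a +′ z *′ eval f z) +′ (ι b +′ z *′ eval g z) ∎

  eval-scale : ∀ a f z → eval (scale a f) z ≈ ι a *′ eval f z
  eval-scale a []      z = ≈.sym (zeroʳ (ι a))
  eval-scale a (b ∷ f) z = begin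
    ι (a ℤ.* b) +′ z *′ eval (scale a f) z
      ≈⟨ +-cong (*-homo a b) (*-congˡ (eval-scale a f z)) ⟩
    ι a *′ ι b +′ z *′ (ι a *′ eval f z)
      ≈⟨ solve 4 (λ a b z f → a :* b :+ z :* (a :* f) := a :* (b :+ z :* f))
           ≈.refl (ι a) (ι b) z (eval f z) ⟩
    ι a *′ (ι b +′ z *′ eval f z) ∎

  eval-linear* : ∀ a b g z → eval (linear* a b g) z ≈ (ι a +′ ι b *′ z) *′ eval g z
  eval-linear* a b g z = begin
    eval (scale a g ⊕ (ℤ.0ℤ ∷ scale b g)) z
      ≈⟨ eval-⊕ (scale a g) (ℤ.0ℤ ∷ scale b g) z ⟩
    eval (scale a g) z +′ (ι ℤ.0ℤ +′ z *′ eval (scale b g) z)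
      ≈⟨ +-cong (eval-scale a g z) (+-cong 0#-homo (*-congˡ (eval-scale b g z))) ⟩
    ι a *′ eval g z +′ (0# +′ z *′ (ι b *′ eval g z))
      ≈⟨ solve 4 (λ a b z g → a :* g :+ (con 0 :+ z :* (b :* g)) := (a :+ b :* z) :* g)
           ≈.refl (ι a) (ι b) z (eval g z) ⟩
    (ι a +′ ι b *′ z) *′ eval g z ∎

  eval-linearProduct : ∀ {n} b (a : Vector ℤ n) z →
    eval (linearProduct b a) z ≈ ∏′ (λ i → ι (a i) +′ ι b *′ z)
  eval-linearProduct {zero} b a z = begin
    ι ℤ.1ℤ +′ z *′ 0#    ≈⟨ +-cong 1#-homo (zeroʳ z) ⟩
    1# +′ 0#             ≈⟨ +-identityʳ 1# ⟩
    1#                   ∎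
  eval-linearProduct {suc n} b a z = ≈.trans
    (eval-linear* (head a) b (linearProduct b (tail a)) z)
    (*-congˡ (eval-linearProduct b (tail a) z))

  -- Stated without subtraction, since `ι` is assumed to be a homomorphism of semirings only. The
  -- value `ι ℤ.-1ℤ` is an opaque `u` for the solver, and 1 + u = 0 then follows from additivity of
  -- `ι`.
  eval-⊝ : ∀ f g z → eval g z +′ eval (f ⊝ g) z ≈ eval f z
  eval-⊝ f g z = begin
    G +′ eval (f ⊝ g) z                        ≈⟨ +-congˡ (eval-⊕ f (scale ℤ.-1ℤ g) z) ⟩
    G +′ (F +′ eval (scale ℤ.-1ℤ g) z)         ≈⟨ +-congˡ (+-congˡ (eval-scale ℤ.-1ℤ g z)) ⟩
    G +′ (F +′ ι ℤ.-1ℤ *′ G)                   ≈⟨ solve 3 (λ f g u → g :+ (f :+ u :* g) := (con 1 :+ u) :* g :+ f)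
                                                    ≈.refl F G (ι ℤ.-1ℤ) ⟩
    (1# +′ ι ℤ.-1ℤ) *′ G +′ F                  ≈⟨ +-congʳ (*-congʳ (+-congʳ (≈.sym 1#-homo))) ⟩
    (ι ℤ.1ℤ +′ ι ℤ.-1ℤ) *′ G +′ F              ≈⟨ +-congʳ (*-congʳ (≈.trans (≈.sym (+-homo ℤ.1ℤ ℤ.-1ℤ)) 0#-homo)) ⟩
    0# *′ G +′ F                               ≈⟨ +-congʳ (zeroˡ G) ⟩
    0# +′ F                                    ≈⟨ +-identityˡ F ⟩
    F                                          ∎
    where
    F G : Carrier
    F = eval f z
    G = eval g z

  IsZero-⊝⇒≈ : ∀ f g z → IsZero (f ⊝ g) → eval f z ≈ eval g z
  IsZero-⊝⇒≈ f g z f⊝g≡0 = begin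
    eval f z                          ≈⟨ eval-⊝ f g z ⟨
    eval g z +′ eval (f ⊝ g) z        ≈⟨ +-congˡ (eval-zero (f ⊝ g) z f⊝g≡0) ⟩
    eval g z +′ 0#                    ≈⟨ +-identityʳ (eval g z) ⟩
    eval g z                          ∎

-- Integer polynomials: growth and bounds on roots.

module ℤ-Evaluation = Evaluation ℤ.+-*-commutativeRing id
  (isSemiringHomomorphism ℤ.+-*-rawSemiring refl)

growth-monic : ∀ m f → MonicOfDegree m f → Growth m (evalℤ f)
growth-monic zero    f       f-monic       = growth-one (λ x → ℤ-Evaluation.eval-monic-0 f x f-monic)
growth-monic (suc m) []      (() , _)
growth-monic (suc m) (a ∷ f) (fₘ≡1 , f≡0) =
  growth-horner {m} a (growth-monic m f (fₘ≡1 , λ k m<k → f≡0 (suc k) (ℕ.s<s m<k)))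

-- If the constant term `a` is nonzero, a root x satisfies a = -(x * y) with y a nonzero integer,
-- hence ∣x∣ ≤ ∣a∣. If `a` is zero, the roots are 0 and the roots of the tail, so the bound of the
-- tail still works.
zero⊎roots-bounded : ∀ f → IsZero f ⊎ ∃ λ B → ∀ x → evalℤ f x ≡ ℤ.0ℤ → ∣ x ∣ ℕ.≤ B
zero⊎roots-bounded [] = inj₁ (λ _ → refl)
zero⊎roots-bounded (a ∷ f) with a ℤ.≟ ℤ.0ℤ | zero⊎roots-bounded f
... | no a≢0 | _ = inj₂ (∣ a ∣ , bound)
  where
  open ℕ.≤-Reasoning
  bound : ∀ x → a + x ℤ.* evalℤ f x ≡ ℤ.0ℤ → ∣ x ∣ ℕ.≤ ∣ a ∣
  bound x fx≡0 = begin
    ∣ x ∣                    ≤⟨ ℕ.m≤m*n ∣ x ∣ ∣ y ∣ ⟩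
    ∣ x ∣ ℕ.* ∣ y ∣          ≡⟨ ℤ.abs-* x y ⟨
    ∣ x ℤ.* y ∣              ≡⟨ ℤ.∣-i∣≡∣i∣ (x ℤ.* y) ⟨
    ∣ ℤ.- (x ℤ.* y) ∣        ≡⟨ cong ∣_∣ a≡-xy ⟨
    ∣ a ∣                    ∎
    where
    open import Algebra.Properties.AbelianGroup ℤ.+-0-abelianGroup using (inverseˡ-unique)
    y : ℤ
    y = evalℤ f x
    a≡-xy : a ≡ ℤ.- (x ℤ.* y)
    a≡-xy = inverseˡ-unique a (x ℤ.* y) fx≡0
    instance
      y≢0 : NonZero ∣ y ∣
      y≢0 = ℕ.≢-nonZero λ ∣y∣≡0 → a≢0
        (trans a≡-xy (cong ℤ.-_ (trans (cong (x ℤ.*_) (ℤ.∣i∣≡0⇒i≡0 ∣y∣≡0)) (ℤ.*-zeroʳ x))))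
... | yes a≡0 | inj₁ f≡0 = inj₁ λ { zero → a≡0 ; (suc k) → f≡0 k }
... | yes refl | inj₂ (B , bound) = inj₂ (B , λ x fx≡0 → root x (ℤ.i*j≡0⇒i≡0∨j≡0 x (trans (sym (ℤ.+-identityˡ _)) fx≡0)))
  where
  root : ∀ x → x ≡ ℤ.0ℤ ⊎ evalℤ f x ≡ ℤ.0ℤ → ∣ x ∣ ℕ.≤ B
  root x (inj₁ refl) = ℕ.z≤n
  root x (inj₂ fx≡0) = bound x fx≡0

-- Rational sequences that tend to 0 or stay away from it.

Null : (ℕ → ℚ) → Set
Null u = ∀ ε → 0ℚ ℚ.< ε → ∃ λ N → ∀ n → N ℕ.≤ n → ℚ.∣ u n ∣ ℚ.< ε

-- A positive witness of staying away from 0; unlike the mere failure of `Null`, it passes to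
-- products termwise.
BoundedBelow : (ℕ → ℚ) → Set
BoundedBelow u = ∃ λ δ → 0ℚ ℚ.< δ × ∃ λ N → ∀ n → N ℕ.≤ n → δ ℚ.≤ u n

null-+ : ∀ u v → Null u → Null v → Null (λ n → u n ℚ.+ v n)
null-+ u v u→0 v→0 ε 0<ε =
  let M , hu = u→0 (½ ℚ.* ε) (0<ε⇒0<½ε 0<ε)
      N , hv = v→0 (½ ℚ.* ε) (0<ε⇒0<½ε 0<ε)
  in M ℕ.⊔ N , λ n p → begin-strict
    ℚ.∣ u n ℚ.+ v n ∣          ≤⟨ ℚ.∣p+q∣≤∣p∣+∣q∣ (u n) (v n) ⟩
    ℚ.∣ u n ∣ ℚ.+ ℚ.∣ v n ∣    <⟨ ℚ.+-mono-< (hu n (ℕ.m⊔n≤o⇒m≤o M N p)) (hv n (ℕ.m⊔n≤o⇒n≤o M N p)) ⟩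
    ½ ℚ.* ε ℚ.+ ½ ℚ.* ε        ≡⟨ ½ε+½ε≡ε ε ⟩
    ε                          ∎
  where open ℚ.≤-Reasoning

null-square : ∀ u → Null u → Null (λ n → u n ℚ.* u n)
null-square u u→0 ε 0<ε =
  let δ , 0<δ , small = tolerance 1ℚ (ℚ.positive (ℚ.positive⁻¹ 1ℚ)) ε 0<ε
      M , hM = u→0 1ℚ (ℚ.positive⁻¹ 1ℚ)
      N , hN = u→0 δ 0<δ
  in M ℕ.⊔ N , λ n p →
    small (ℚ.<⇒≤ (hM n (ℕ.m⊔n≤o⇒m≤o M N p))) (hN n (ℕ.m⊔n≤o⇒n≤o M N p))

0≤p² : ∀ p → 0ℚ ℚ.≤ p ℚ.* p
0≤p² p = subst (0ℚ ℚ.≤_) ∣p∣²≡p²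
  (ℚ.nonNegative⁻¹ _ {{ℚ.nonNeg*nonNeg⇒nonNeg ℚ.∣ p ∣ ℚ.∣ p ∣}})
  where
  instance
    ∣p∣-nonNeg : ℚ.NonNegative ℚ.∣ p ∣
    ∣p∣-nonNeg = ℚ.∣-∣-nonNeg p
  ∣p∣²≡p² : ℚ.∣ p ∣ ℚ.* ℚ.∣ p ∣ ≡ p ℚ.* p
  ∣p∣²≡p² with ℚ.∣p∣≡p∨∣p∣≡-p p
  ... | inj₁ eq = cong₂ ℚ._*_ eq eq
  ... | inj₂ eq = trans (cong₂ ℚ._*_ eq eq) (solve 1 (λ p → (:- p) :* (:- p) := p :* p) refl p)
    where open ℚ.+-*-Solver

square-cancel-< : ∀ p {ε} → 0ℚ ℚ.< ε → p ℚ.* p ℚ.< ε ℚ.* ε → ℚ.∣ p ∣ ℚ.< ε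
square-cancel-< p {ε} 0<ε p²<ε² = ℚ.≰⇒> λ ε≤∣p∣ → ℚ.<-irrefl refl (ℚ.<-≤-trans p²<ε² (begin
  ε ℚ.* ε                ≤⟨ ℚ.*-monoˡ-≤-nonNeg ε ε≤∣p∣ ⟩
  ε ℚ.* ℚ.∣ p ∣          ≤⟨ ℚ.*-monoʳ-≤-nonNeg ℚ.∣ p ∣ ε≤∣p∣ ⟩
  ℚ.∣ p ∣ ℚ.* ℚ.∣ p ∣    ≡⟨ ℚ.∣p*q∣≡∣p∣*∣q∣ p p ⟨
  ℚ.∣ p ℚ.* p ∣          ≡⟨ ℚ.0≤p⇒∣p∣≡p (0≤p² p) ⟩
  p ℚ.* p                ∎))
  where
  open ℚ.≤-Reasoning
  instance
    ε-nonNeg : ℚ.NonNegative ε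
    ε-nonNeg = ℚ.nonNegative (ℚ.<⇒≤ 0<ε)
    ∣p∣-nonNeg : ℚ.NonNegative ℚ.∣ p ∣
    ∣p∣-nonNeg = ℚ.∣-∣-nonNeg p

0<p*q : ∀ {p q} → 0ℚ ℚ.< p → 0ℚ ℚ.< q → 0ℚ ℚ.< p ℚ.* q
0<p*q {p} {q} 0<p 0<q =
  ℚ.positive⁻¹ (p ℚ.* q) {{ℚ.pos*pos⇒pos p {{ℚ.positive 0<p}} q {{ℚ.positive 0<q}}}}

-- Since u² ≤ u² + v, testing the sum against ε² gives ∣u∣ < ε. It recovers each coordinate from a
-- squared distance.
null-squareʳ⁻ : (u v : ℕ → ℚ) → (∀ n → 0ℚ ℚ.≤ v n) → Null (λ n → u n ℚ.* u n ℚ.+ v n) → Null u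
null-squareʳ⁻ u v 0≤v u²+v→0 ε 0<ε =
  let N , h = u²+v→0 (ε ℚ.* ε) (0<p*q 0<ε 0<ε)
  in N , λ n p → square-cancel-< (u n) 0<ε (begin-strict
    u n ℚ.* u n                  ≡⟨ ℚ.+-identityʳ (u n ℚ.* u n) ⟨
    u n ℚ.* u n ℚ.+ 0ℚ           ≤⟨ ℚ.+-monoʳ-≤ (u n ℚ.* u n) (0≤v n) ⟩
    u n ℚ.* u n ℚ.+ v n          ≤⟨ p≤∣p∣ (u n ℚ.* u n ℚ.+ v n) ⟩
    ℚ.∣ u n ℚ.* u n ℚ.+ v n ∣    <⟨ h n p ⟩
    ε ℚ.* ε                      ∎)
  where
  open ℚ.≤-Reasoning
  p≤∣p∣ : ∀ p → p ℚ.≤ ℚ.∣ p ∣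
  p≤∣p∣ p with ℚ.≤-total 0ℚ p
  ... | inj₁ 0≤p = ℚ.≤-reflexive (sym (ℚ.0≤p⇒∣p∣≡p 0≤p))
  ... | inj₂ p≤0 = ℚ.≤-trans p≤0 (ℚ.0≤∣p∣ p)

null⇒¬boundedBelow : ∀ {u} → Null u → ¬ BoundedBelow u
null⇒¬boundedBelow {u} u→0 (δ , 0<δ , M , δ≤u) =
  let N , h = u→0 δ 0<δ
      n = M ℕ.⊔ N
      δ≤un = δ≤u n (ℕ.m≤m⊔n M N)
  in ℚ.<-irrefl refl (ℚ.<-≤-trans (h n (ℕ.m≤n⊔m M N))
       (subst (δ ℚ.≤_) (sym (ℚ.0≤p⇒∣p∣≡p (ℚ.≤-trans (ℚ.<⇒≤ 0<δ) δ≤un))) δ≤un))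

boundedBelow-cong : ∀ {u v} → (∀ n → u n ≡ v n) → BoundedBelow u → BoundedBelow v
boundedBelow-cong u≡v (δ , 0<δ , N , δ≤u) =
  δ , 0<δ , N , λ n p → subst (δ ℚ.≤_) (u≡v n) (δ≤u n p)

boundedBelow-* : ∀ {u v} → BoundedBelow u → BoundedBelow v → BoundedBelow (λ n → u n ℚ.* v n)
boundedBelow-* {u} {v} (δ , 0<δ , M , δ≤u) (η , 0<η , N , η≤v) =
  δ ℚ.* η , 0<p*q 0<δ 0<η , M ℕ.⊔ N , λ n p →
    let δ≤un = δ≤u n (ℕ.m⊔n≤o⇒m≤o M N p)
        η≤vn = η≤v n (ℕ.m⊔n≤o⇒n≤o M N p)
    in begin
      δ ℚ.* η        ≤⟨ ℚ.*-monoʳ-≤-nonNeg η {{ℚ.nonNegative (ℚ.<⇒≤ 0<η)}} δ≤un ⟩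
      u n ℚ.* η      ≤⟨ ℚ.*-monoˡ-≤-nonNeg (u n)
                          {{ℚ.nonNegative (ℚ.≤-trans (ℚ.<⇒≤ 0<δ) δ≤un)}} η≤vn ⟩
      u n ℚ.* v n    ∎
  where open ℚ.≤-Reasoning

∣p∣≤∣q∣+∣p-q∣ : ∀ p q → ℚ.∣ p ∣ ℚ.≤ ℚ.∣ q ∣ ℚ.+ ℚ.∣ p ℚ.- q ∣
∣p∣≤∣q∣+∣p-q∣ p q = subst (λ t → ℚ.∣ t ∣ ℚ.≤ ℚ.∣ q ∣ ℚ.+ ℚ.∣ p ℚ.- q ∣)
  (solve 2 (λ p q → q :+ (p :- q) := p) refl p q) (ℚ.∣p+q∣≤∣p∣+∣q∣ q (p ℚ.- q))
  where open ℚ.+-*-Solver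

-- One late term `u K` settles the matter, by a decidable comparison of rationals. If it is below
-- ε/2, all later terms are below ε. Otherwise a later term below ε/4 would pull `u K` under ε/2, so
-- ε/4 bounds the tail from below, against the hypothesis.
¬boundedBelow⇒null : ∀ {u} → Cauchy u → (∀ n → 0ℚ ℚ.≤ u n) → ¬ BoundedBelow u → Null u
¬boundedBelow⇒null {u} cu 0≤u ¬bb ε 0<ε = decide (u K ℚ.<? ½ ℚ.* ε)
  where
  0<½ε : 0ℚ ℚ.< ½ ℚ.* ε
  0<½ε = 0<ε⇒0<½ε 0<ε

  0<¼ε : 0ℚ ℚ.< ½ ℚ.* (½ ℚ.* ε)
  0<¼ε = 0<ε⇒0<½ε 0<½ε

  K M N : ℕ
  M = proj₁ (cu (½ ℚ.* ε) 0<½ε)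
  N = proj₁ (cu (½ ℚ.* (½ ℚ.* ε)) 0<¼ε)
  K = M ℕ.⊔ N

  near : ∀ m n η → u n ℚ.< ½ ℚ.* η → ℚ.∣ u m ℚ.- u n ∣ ℚ.< ½ ℚ.* η → ℚ.∣ u m ∣ ℚ.< η
  near m n η un< um-un< = begin-strict
    ℚ.∣ u m ∣                          ≤⟨ ∣p∣≤∣q∣+∣p-q∣ (u m) (u n) ⟩
    ℚ.∣ u n ∣ ℚ.+ ℚ.∣ u m ℚ.- u n ∣    ≡⟨ cong (ℚ._+ ℚ.∣ u m ℚ.- u n ∣) (ℚ.0≤p⇒∣p∣≡p (0≤u n)) ⟩
    u n ℚ.+ ℚ.∣ u m ℚ.- u n ∣          <⟨ ℚ.+-mono-< un< um-un< ⟩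
    ½ ℚ.* η ℚ.+ ½ ℚ.* η                ≡⟨ ½ε+½ε≡ε η ⟩
    η                                  ∎
    where open ℚ.≤-Reasoning

  decide : Dec (u K ℚ.< ½ ℚ.* ε) → ∃ λ K → ∀ n → K ℕ.≤ n → ℚ.∣ u n ∣ ℚ.< ε
  decide (yes uK<½ε) = K , λ n p →
    near n K ε uK<½ε
      (proj₂ (cu (½ ℚ.* ε) 0<½ε) n K (ℕ.m⊔n≤o⇒m≤o M N p) (ℕ.m≤m⊔n M N))
  decide (no uK≮½ε) = contradiction
    (½ ℚ.* (½ ℚ.* ε) , 0<¼ε , K , λ n p → ℚ.≮⇒≥ λ un<¼ε → uK≮½ε
      (subst (ℚ._< ½ ℚ.* ε) (ℚ.0≤p⇒∣p∣≡p (0≤u K))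
        (near K n (½ ℚ.* ε) un<¼ε
          (proj₂ (cu (½ ℚ.* (½ ℚ.* ε)) 0<¼ε) K n (ℕ.m≤n⊔m M N) (ℕ.m⊔n≤o⇒n≤o M N p)))))
    ¬bb

-- The embedding of ℤ in ℚ and the ring of Gaussian rationals.

fromℚᵘ-homo-+ : ∀ p q → ℚ.fromℚᵘ (p ℚᵘ.+ q) ≡ ℚ.fromℚᵘ p ℚ.+ ℚ.fromℚᵘ q
fromℚᵘ-homo-+ p q = ℚ.toℚᵘ-injective (begin-equality
  ℚ.toℚᵘ (ℚ.fromℚᵘ (p ℚᵘ.+ q))                           ≃⟨ ℚ.toℚᵘ-fromℚᵘ (p ℚᵘ.+ q) ⟩
  p ℚᵘ.+ q                                               ≃⟨ ℚᵘ.+-cong (ℚ.toℚᵘ-fromℚᵘ p) (ℚ.toℚᵘ-fromℚᵘ q) ⟨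
  ℚ.toℚᵘ (ℚ.fromℚᵘ p) ℚᵘ.+ ℚ.toℚᵘ (ℚ.fromℚᵘ q)           ≃⟨ ℚ.toℚᵘ-homo-+ (ℚ.fromℚᵘ p) (ℚ.fromℚᵘ q) ⟨
  ℚ.toℚᵘ (ℚ.fromℚᵘ p ℚ.+ ℚ.fromℚᵘ q)                     ∎)
  where open ℚᵘ.≤-Reasoning

fromℚᵘ-homo-* : ∀ p q → ℚ.fromℚᵘ (p ℚᵘ.* q) ≡ ℚ.fromℚᵘ p ℚ.* ℚ.fromℚᵘ q
fromℚᵘ-homo-* p q = ℚ.toℚᵘ-injective (begin-equality
  ℚ.toℚᵘ (ℚ.fromℚᵘ (p ℚᵘ.* q))                           ≃⟨ ℚ.toℚᵘ-fromℚᵘ (p ℚᵘ.* q) ⟩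
  p ℚᵘ.* q                                               ≃⟨ ℚᵘ.*-cong (ℚ.toℚᵘ-fromℚᵘ p) (ℚ.toℚᵘ-fromℚᵘ q) ⟨
  ℚ.toℚᵘ (ℚ.fromℚᵘ p) ℚᵘ.* ℚ.toℚᵘ (ℚ.fromℚᵘ q)           ≃⟨ ℚ.toℚᵘ-homo-* (ℚ.fromℚᵘ p) (ℚ.fromℚᵘ q) ⟨
  ℚ.toℚᵘ (ℚ.fromℚᵘ p ℚ.* ℚ.fromℚᵘ q)                     ∎)
  where open ℚᵘ.≤-Reasoning

/1-homo-+ : ∀ a b → (a ℤ.+ b) ℚ./ 1 ≡ a ℚ./ 1 ℚ.+ b ℚ./ 1
/1-homo-+ a b = trans
  -- Unnormalised addition cross-multiplies, so its numerator is a * 1 + b * 1. The `0` in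
  -- `mkℚᵘ a 0` stores the denominator 1 minus one.
  (cong (ℚ._/ 1) (sym (cong₂ ℤ._+_ (ℤ.*-identityʳ a) (ℤ.*-identityʳ b))))
  (fromℚᵘ-homo-+ (mkℚᵘ a 0) (mkℚᵘ b 0))

/1-homo-* : ∀ a b → (a ℤ.* b) ℚ./ 1 ≡ (a ℚ./ 1) ℚ.* (b ℚ./ 1)
/1-homo-* a b = fromℚᵘ-homo-* (mkℚᵘ a 0) (mkℚᵘ b 0)

/1-homo-neg : ∀ a → (ℤ.- a) ℚ./ 1 ≡ ℚ.- (a ℚ./ 1)
/1-homo-neg a = inverseˡ-unique ((ℤ.- a) ℚ./ 1) (a ℚ./ 1)
  (trans (sym (/1-homo-+ (ℤ.- a) a)) (cong (ℚ._/ 1) (ℤ.+-inverseˡ a)))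
  where open import Algebra.Properties.AbelianGroup ℚ.+-0-abelianGroup using (inverseˡ-unique)

-- The product is spelled exactly as in `ℂ-rawRing`, so that taking the n-th term of a complex
-- product yields this product by computation.
ℚ[i] : CommutativeRing 0ℓ 0ℓ
ℚ[i] = record
  { _*_ = λ (a , b) (c , d) → a ℚ.* c ℚ.+ (ℚ.- (b ℚ.* d)) , a ℚ.* d ℚ.+ b ℚ.* c
  ; 1#  = 1ℚ , 0ℚ
  ; isCommutativeRing = record
    { isRing = record
      { +-isAbelianGroup = AbelianGroup.isAbelianGroup
          (DirectProduct.abelianGroup ℚ.+-0-abelianGroup ℚ.+-0-abelianGroup)
      ; *-cong = λ { (refl , refl) (refl , refl) → refl , refl }
      ; *-assoc = λ (a , b) (c , d) (e , f) →
          solve 6 (λ a b c d e f →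
            (a :* c :+ (:- (b :* d))) :* e :+ (:- ((a :* d :+ b :* c) :* f)) :=
            a :* (c :* e :+ (:- (d :* f))) :+ (:- (b :* (c :* f :+ d :* e))))
            refl a b c d e f ,
          solve 6 (λ a b c d e f →
            (a :* c :+ (:- (b :* d))) :* f :+ (a :* d :+ b :* c) :* e :=
            a :* (c :* f :+ d :* e) :+ b :* (c :* e :+ (:- (d :* f))))
            refl a b c d e f
      ; *-identity =
          (λ (a , b) →
            solve 2 (λ a b → con 1ℚ :* a :+ (:- (con 0ℚ :* b)) := a) refl a b ,
            solve 2 (λ a b → con 1ℚ :* b :+ con 0ℚ :* a := b) refl a b) ,
          (λ (a , b) →
            solve 2 (λ a b → a :* con 1ℚ :+ (:- (b :* con 0ℚ)) := a) refl a b ,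
            solve 2 (λ a b → a :* con 0ℚ :+ b :* con 1ℚ := b) refl a b)
      ; distrib =
          (λ (a , b) (c , d) (e , f) →
            solve 6 (λ a b c d e f →
              a :* (c :+ e) :+ (:- (b :* (d :+ f))) :=
              (a :* c :+ (:- (b :* d))) :+ (a :* e :+ (:- (b :* f))))
              refl a b c d e f ,
            solve 6 (λ a b c d e f →
              a :* (d :+ f) :+ b :* (c :+ e) :=
              (a :* d :+ b :* c) :+ (a :* f :+ b :* e))
              refl a b c d e f) ,
          (λ (a , b) (c , d) (e , f) →
            solve 6 (λ a b c d e f →
              (c :+ e) :* a :+ (:- ((d :+ f) :* b)) :=
              (c :* a :+ (:- (d :* b))) :+ (e :* a :+ (:- (f :* b))))
              refl a b c d e f ,
            solve 6 (λ a b c d e f →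
              (c :+ e) :* b :+ (d :+ f) :* a :=
              (c :* b :+ d :* a) :+ (e :* b :+ f :* a))
              refl a b c d e f)
      }
    ; *-comm = λ (a , b) (c , d) →
        solve 4 (λ a b c d → a :* c :+ (:- (b :* d)) := c :* a :+ (:- (d :* b))) refl a b c d ,
        solve 4 (λ a b c d → a :* d :+ b :* c := c :* b :+ d :* a) refl a b c d
    }
  }
  where open ℚ.+-*-Solver

module ℚ[i] = CommutativeRing ℚ[i]

ι : ℤ → ℚ[i].Carrier
ι k = k ℚ./ 1 , 0ℚ

ι-homo : SemiringMorphisms.IsSemiringHomomorphism
  ℤ.+-*-rawSemiring (RawRing.rawSemiring ℚ[i].rawRing) ι
ι-homo = record
  { isNearSemiringHomomorphism = record
    { +-isMonoidHomomorphism = record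
      { isMagmaHomomorphism = record
        { isRelHomomorphism = record { cong = λ { refl → refl , refl } }
        ; homo = λ a b → /1-homo-+ a b , refl }
      ; ε-homo = refl , refl }
    ; *-homo = λ a b →
        trans (/1-homo-* a b) (sym (ℚ.+-identityʳ _)) ,
        solve 2 (λ a b → con 0ℚ := a :* con 0ℚ :+ con 0ℚ :* b) refl (a ℚ./ 1) (b ℚ./ 1) }
  ; 1#-homo = refl , refl }
  where open ℚ.+-*-Solver

module ℚ[i]-Evaluation = Evaluation ℚ[i] ι ι-homo
open ℚ[i]-Evaluation

-- Norms, and the transfer from complex roots to Gaussian rationals.

norm : ℚ[i].Carrier → ℚ
norm (a , b) = a ℚ.* a ℚ.+ b ℚ.* b

norm-cong : ∀ {z w} → z ℚ[i].≈ w → norm z ≡ norm w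
norm-cong (refl , refl) = refl

-- The two-square identity of Brahmagupta.
norm-* : ∀ z w → norm (z ℚ[i].* w) ≡ norm z ℚ.* norm w
norm-* (a , b) (c , d) = solve 4 (λ a b c d →
  (a :* c :+ (:- (b :* d))) :* (a :* c :+ (:- (b :* d))) :+ (a :* d :+ b :* c) :* (a :* d :+ b :* c) :=
  (a :* a :+ b :* b) :* (c :* c :+ d :* d)) refl a b c d
  where open ℚ.+-*-Solver

infix 9 _at_

_at_ : ℂ → ℕ → ℚ[i].Carrier
z at n = seq (re z) n , seq (im z) n

-- Real operations act termwise, so evaluation commutes with taking the n-th term exactly and not
-- only in the limit.
evalℂ-at : ∀ f z n → evalℂ f z at n ≡ eval f (z at n)
evalℂ-at []      z n = refl
evalℂ-at (a ∷ f) z n = cong (λ w → ι a ℚ[i].+ z at n ℚ[i].* w) (evalℂ-at f z n)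

root⇒norm-null : ∀ f z → IsRoot f z → Null (λ n → norm (eval f (z at n)))
root⇒norm-null f z (re≈0 , im≈0) ε 0<ε =
  let N , h = null-+ _ _ (null-square x (seq-null (re w) re≈0)) (null-square y (seq-null (im w) im≈0)) ε 0<ε
  in N , λ n p → subst (λ v → ℚ.∣ norm v ∣ ℚ.< ε) (evalℂ-at f z n) (h n p)
  where
  w : ℂ
  w = evalℂ f z
  x y : ℕ → ℚ
  x = seq (re w)
  y = seq (im w)
  seq-null : ∀ x → x ≈ℝ fromℚ 0ℚ → Null (seq x)
  seq-null x x≈0 ε 0<ε =
    let N , h = x≈0 ε 0<ε
    in N , λ n p → subst (λ t → ℚ.∣ t ∣ ℚ.< ε) (ℚ.+-identityʳ (seq x n)) (h n p)

distance² : ℂ → ℂ → ℝ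
distance² z w = (x *ℝ x) +ℝ (y *ℝ y)
  where
  x y : ℝ
  x = re z +ℝ (-ℝ re w)
  y = im z +ℝ (-ℝ im w)

distance²-null⇒≈ : ∀ z w → Null (seq (distance² z w)) → z ≈ℂ w
distance²-null⇒≈ z w d→0 =
  null-squareʳ⁻ x (λ n → y n ℚ.* y n) (λ n → 0≤p² (y n)) d→0 ,
  null-squareʳ⁻ y (λ n → x n ℚ.* x n) (λ n → 0≤p² (x n)) λ ε 0<ε →
    let N , h = d→0 ε 0<ε
    in N , λ n p → subst (λ t → ℚ.∣ t ∣ ℚ.< ε) (ℚ.+-comm (x n ℚ.* x n) (y n ℚ.* y n)) (h n p)
  where
  x y : ℕ → ℚ
  x n = seq (re z) n ℚ.- seq (re w) n
  y n = seq (im z) n ℚ.- seq (im w) n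

-- Were the squared distance to `k` not bounded below, it would be null as a nonnegative Cauchy
-- sequence, and then z ≈ k.
¬IsInteger⇒¬¬distance²-boundedBelow : ∀ z → ¬ IsInteger z → ∀ k →
  ¬ ¬ BoundedBelow (seq (distance² z (fromℤ k)))
¬IsInteger⇒¬¬distance²-boundedBelow z z∉ℤ k ¬bb =
  z∉ℤ (k , distance²-null⇒≈ z (fromℤ k)
    (¬boundedBelow⇒null (cauchy (distance² z (fromℤ k)))
      (λ n → ℚ.+-mono-≤ (0≤p² (seq (re z) n ℚ.- k ℚ./ 1)) (0≤p² (seq (im z) n ℚ.- 0ℚ))) ¬bb))

-- As `s ◃ 1` is ±1, the factor is ±(z - k): e + z vanishes at k = -e, and e - z at k = e.
norm-linear : ∀ s e z → ∃ λ k → ∀ n →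
  norm (ι e ℚ[i].+ ι (s ◃ 1) ℚ[i].* z at n) ≡ seq (distance² z (fromℤ k)) n
norm-linear Sign.+ e z = ℤ.- e , λ n →
  trans (identity (e ℚ./ 1) (seq (re z) n) (seq (im z) n))
        (cong (λ k → norm (seq (re z) n ℚ.- k , seq (im z) n ℚ.- 0ℚ)) (sym (/1-homo-neg e)))
  where
  open ℚ.+-*-Solver
  identity : ∀ e a b → norm ((e , 0ℚ) ℚ[i].+ (1ℚ , 0ℚ) ℚ[i].* (a , b)) ≡ norm (a ℚ.- (ℚ.- e) , b ℚ.- 0ℚ)
  identity = solve 3 (λ e a b →
    (e :+ (con 1ℚ :* a :+ (:- (con 0ℚ :* b)))) :* (e :+ (con 1ℚ :* a :+ (:- (con 0ℚ :* b)))) :+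
    (con 0ℚ :+ (con 1ℚ :* b :+ con 0ℚ :* a)) :* (con 0ℚ :+ (con 1ℚ :* b :+ con 0ℚ :* a)) :=
    (a :- (:- e)) :* (a :- (:- e)) :+ (b :- con 0ℚ) :* (b :- con 0ℚ)) refl
norm-linear Sign.- e z = e , λ n → identity (e ℚ./ 1) (seq (re z) n) (seq (im z) n)
  where
  open ℚ.+-*-Solver
  -1ℚ : ℚ
  -1ℚ = ℚ.- 1ℚ
  identity : ∀ e a b → norm ((e , 0ℚ) ℚ[i].+ (-1ℚ , 0ℚ) ℚ[i].* (a , b)) ≡ norm (a ℚ.- e , b ℚ.- 0ℚ)
  identity = solve 3 (λ e a b →
    (e :+ (con -1ℚ :* a :+ (:- (con 0ℚ :* b)))) :* (e :+ (con -1ℚ :* a :+ (:- (con 0ℚ :* b)))) :+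
    (con 0ℚ :+ (con -1ℚ :* b :+ con 0ℚ :* a)) :* (con 0ℚ :+ (con -1ℚ :* b :+ con 0ℚ :* a)) :=
    (a :- e) :* (a :- e) :+ (b :- con 0ℚ) :* (b :- con 0ℚ)) refl

-- A complex number that is not ≈ 0 is bounded away from 0 only up to ¬¬; the
-- bound is used to derive a contradiction, so this is enough.
¬IsInteger⇒¬¬norm-boundedBelow : ∀ z → ¬ IsInteger z → ∀ s {m} (e : Vector ℤ m) →
  ¬ ¬ BoundedBelow (λ n → norm (∏′ (λ i → ι (e i) ℚ[i].+ ι (s ◃ 1) ℚ[i].* z at n)))
¬IsInteger⇒¬¬norm-boundedBelow z z∉ℤ s {zero}  e ¬bb =
  ¬bb (1ℚ , ℚ.positive⁻¹ 1ℚ , 0 , λ _ _ → ℚ.≤-refl)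
¬IsInteger⇒¬¬norm-boundedBelow z z∉ℤ s {suc m} e ¬bb =
  let k , norm≡d = norm-linear s (head e) z
  in ¬IsInteger⇒¬¬distance²-boundedBelow z z∉ℤ k λ d-bb →
     ¬IsInteger⇒¬¬norm-boundedBelow z z∉ℤ s (tail e) λ (δ , 0<δ , N , h) →
     ¬bb (boundedBelow-cong
       (λ n → trans (cong (ℚ._* norm (∏′ (factor n ∘ tail e))) (sym (norm≡d n)))
                    (sym (norm-* (factor n (head e)) (∏′ (factor n ∘ tail e)))))
       (boundedBelow-* d-bb (δ , 0<δ , N , h)))
  where
  factor : ℕ → ℤ → ℚ[i].Carrier
  factor n a = ι a ℚ[i].+ ι (s ◃ 1) ℚ[i].* z at n

-- Otherwise `f` and the product agree at every Gaussian rational approximation of `z`. The norms of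
-- the values of `f` tend to 0, whereas those of the product are, up to double negation, bounded
-- away from 0.
root∉ℤ⇒¬IsZero : ∀ f z → IsRoot f z → ¬ IsInteger z → ∀ s {m} (e : Vector ℤ m) →
  ¬ IsZero (linearProduct (s ◃ 1) e ⊝ f)
root∉ℤ⇒¬IsZero f z fz≈0 z∉ℤ s e p⊝f≡0 =
  ¬IsInteger⇒¬¬norm-boundedBelow z z∉ℤ s e λ bb →
  null⇒¬boundedBelow (root⇒norm-null f z fz≈0) (boundedBelow-cong norm≡ bb)
  where
  norm≡ : ∀ n → norm (∏′ (λ i → ι (e i) ℚ[i].+ ι (s ◃ 1) ℚ[i].* z at n)) ≡ norm (eval f (z at n))
  norm≡ n = norm-cong (ℚ[i].trans
    (ℚ[i].sym (eval-linearProduct (s ◃ 1) e (z at n)))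
    (IsZero-⊝⇒≈ (linearProduct (s ◃ 1) e) f (z at n) p⊝f≡0))

-- Such an `f` takes the constant value 1, whose norm is not null. This settles degree 0, which the
-- growth comparison excludes.
root⇒¬monic-0 : ∀ f z → IsRoot f z → ¬ MonicOfDegree 0 f
root⇒¬monic-0 f z fz≈0 f-monic =
  null⇒¬boundedBelow (root⇒norm-null f z fz≈0)
    (1ℚ , ℚ.positive⁻¹ 1ℚ , 0 , λ n _ →
      ℚ.≤-reflexive (sym (norm-cong (eval-monic-0 f (z at n) f-monic))))

-- Finite boxes, and the lines of slope ±1 that carry the solutions.

ball : ℕ → List ℤ
ball K = map ℤ.+_ (upTo (suc K)) ++ map (ℤ.-_ ∘ ℤ.+_) (upTo (suc K))

∣i∣≤K⇒i∈ball : ∀ {K} i → ∣ i ∣ ℕ.≤ K → i ∈ ball K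
∣i∣≤K⇒i∈ball {K} (ℤ.+ n) n≤K = ∈-++⁺ˡ (∈-map⁺ ℤ.+_ (∈-upTo⁺ (ℕ.s≤s n≤K)))
∣i∣≤K⇒i∈ball {K} ℤ.-[1+ n ] n<K =
  ∈-++⁺ʳ (map ℤ.+_ (upTo (suc K))) (∈-map⁺ (ℤ.-_ ∘ ℤ.+_) (∈-upTo⁺ (ℕ.s≤s n<K)))

-- `Finite` asks for a list of exactly the members, so the enclosing box is filtered by the decision
-- procedure.
bounded⇒finite : ∀ {p} {P : Pred (ℤ × ℤ) p} → Decidable P → ∀ B →
  (∀ x y → P (x , y) → ∣ x ∣ ℕ.≤ B × ∣ y ∣ ℕ.≤ B) → Finite P
bounded⇒finite P? B bound = filter P? box , λ (x , y) → mk⇔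
  (λ p → let x≤B , y≤B = bound x y p
         in ∈-filter⁺ P? (∈-cartesianProduct⁺ (∣i∣≤K⇒i∈ball x x≤B) (∣i∣≤K⇒i∈ball y y≤B)) p)
  (λ xy∈ → proj₂ (∈-filter⁻ P? {xs = box} xy∈))
  where
  box : List (ℤ × ℤ)
  box = cartesianProduct (ball B) (ball B)

signs : List Sign
signs = Sign.+ ∷ Sign.- ∷ []

∈-signs : ∀ s → s ∈ signs
∈-signs Sign.+ = here refl
∈-signs Sign.- = there (here refl)

∏-cong : ∀ {m} {u v : Vector ℤ m} → (∀ i → u i ≡ v i) → ∏ u ≡ ∏ v
∏-cong {zero}  u≡v = refl
∏-cong {suc m} u≡v = cong₂ ℤ._*_ (u≡v Fin.zero) (∏-cong (u≡v ∘ Fin.suc))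

∣m⊖n∣≤K : ∀ {K} m n → m ℕ.≤ n ℕ.+ K → n ℕ.≤ m ℕ.+ K → ∣ m ℤ.⊖ n ∣ ℕ.≤ K
∣m⊖n∣≤K m n m≤n+K n≤m+K with ℕ.≤-total m n
... | inj₁ m≤n = subst (ℕ._≤ _) (sym (ℤ.∣⊖∣-≤ m≤n)) (ℕ.m≤n+o⇒m∸n≤o n m n≤m+K)
... | inj₂ n≤m = subst (ℕ._≤ _) (sym (trans (ℤ.∣m⊖n∣≡∣n⊖m∣ m n) (ℤ.∣⊖∣-≤ n≤m))) (ℕ.m≤n+o⇒m∸n≤o m n m≤n+K)

-- The hypotheses say that ∣y∣ and ∣x∣ differ by at most `K`. Writing each absolute value as plus or
-- minus its argument turns the difference into ±(y - x) when the two signs agree and ±(y + x) when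
-- they do not.
∣y-±x∣≤K : ∀ {K} x y → ∣ x ∣ ℕ.≤ ∣ y ∣ ℕ.+ K → ∣ y ∣ ℕ.≤ ∣ x ∣ ℕ.+ K →
  ∃ λ s → ∣ y ℤ.- (s ◃ 1) ℤ.* x ∣ ℕ.≤ K
∣y-±x∣≤K {K} x y x≤y+K y≤x+K = choose (ℤ.+∣i∣≡i⊎+∣i∣≡-i x) (ℤ.+∣i∣≡i⊎+∣i∣≡-i y)
  where
  open ℤ.+-*-Solver
  X Y : ℤ
  X = ℤ.+ ∣ x ∣
  Y = ℤ.+ ∣ y ∣

  Y-X≤K : ∣ Y ℤ.- X ∣ ℕ.≤ K
  Y-X≤K = subst (λ i → ∣ i ∣ ℕ.≤ K) (sym (ℤ.m-n≡m⊖n ∣ y ∣ ∣ x ∣)) (∣m⊖n∣≤K ∣ y ∣ ∣ x ∣ y≤x+K x≤y+K)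

  slope : ∀ s {i j} → X ≡ i → Y ≡ j → ∣ j ℤ.- i ∣ ≡ ∣ y ℤ.- (s ◃ 1) ℤ.* x ∣ →
    ∃ λ s → ∣ y ℤ.- (s ◃ 1) ℤ.* x ∣ ℕ.≤ K
  slope s refl refl eq = s , subst (ℕ._≤ K) eq Y-X≤K

  choose : X ≡ x ⊎ X ≡ ℤ.- x → Y ≡ y ⊎ Y ≡ ℤ.- y → ∃ λ s → ∣ y ℤ.- (s ◃ 1) ℤ.* x ∣ ℕ.≤ K
  choose (inj₁ X≡x) (inj₁ Y≡y) = slope Sign.+ X≡x Y≡y
    (cong ∣_∣ (solve 2 (λ x y → y :- x := y :- con ℤ.1ℤ :* x) refl x y))
  choose (inj₂ X≡-x) (inj₁ Y≡y) = slope Sign.- X≡-x Y≡y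
    (cong ∣_∣ (solve 2 (λ x y → y :- (:- x) := y :- con ℤ.-1ℤ :* x) refl x y))
  -- When ∣y∣ = -y the whole difference is negated, so that y appears with coefficient 1.
  choose (inj₁ X≡x) (inj₂ Y≡-y) = slope Sign.- X≡x Y≡-y (trans
    (sym (ℤ.∣-i∣≡∣i∣ (ℤ.- y ℤ.- x)))
    (cong ∣_∣ (solve 2 (λ x y → :- (:- y :- x) := y :- con ℤ.-1ℤ :* x) refl x y)))
  choose (inj₂ X≡-x) (inj₂ Y≡-y) = slope Sign.+ X≡-x Y≡-y (trans
    (sym (ℤ.∣-i∣≡∣i∣ (ℤ.- y ℤ.- ℤ.- x)))
    (cong ∣_∣ (solve 2 (λ x y → :- (:- y :- (:- x)) := y :- con ℤ.1ℤ :* x) refl x y)))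

-- The line of slope ±1 through (x , y) has intercept c = y - (±x), and at x the factor (c + qᵢ) ± x
-- is y + qᵢ again.
solution⇒root : ∀ f s {m} (q : Vector ℤ m) x y → ∏ (λ i → y + q i) ≡ evalℤ f x →
  evalℤ (linearProduct (s ◃ 1) (λ i → y ℤ.- (s ◃ 1) ℤ.* x + q i) ⊝ f) x ≡ ℤ.0ℤ
solution⇒root f s q x y ∏≡fx = identityʳ-unique (evalℤ f x) (evalℤ (p ⊝ f) x) (begin
  evalℤ f x + evalℤ (p ⊝ f) x
    ≡⟨ ℤ-Evaluation.eval-⊝ p f x ⟩
  evalℤ p x
    ≡⟨ ℤ-Evaluation.eval-linearProduct (s ◃ 1) (λ i → y ℤ.- (s ◃ 1) ℤ.* x + q i) x ⟩
  ∏ (λ i → (y ℤ.- (s ◃ 1) ℤ.* x + q i) + (s ◃ 1) ℤ.* x)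
    ≡⟨ ∏-cong (λ i → solve 4 (λ y ε x q → (y :- ε :* x :+ q) :+ ε :* x := y :+ q) refl y (s ◃ 1) x (q i)) ⟩
  ∏ (λ i → y + q i)
    ≡⟨ ∏≡fx ⟩
  evalℤ f x ∎)
  where
  open ℤ.+-*-Solver
  open ≡-Reasoning
  open import Algebra.Properties.AbelianGroup ℤ.+-0-abelianGroup using (identityʳ-unique)
  p : ℤ[x]
  p = linearProduct (s ◃ 1) (λ i → y ℤ.- (s ◃ 1) ℤ.* x + q i)

theorem1p2 : (m : ℕ) (f : ℤ[x]) → MonicOfDegree m f →
    (∃ λ (z : ℂ) → IsRoot f z × ¬ IsInteger z) →
    (q : Vector ℤ m) →
    Finite λ ((x , y) : ℤ × ℤ) → ∏ (λ i → y + q i) ≡ evalℤ f x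
theorem1p2 zero    f f-monic (z , fz≈0 , _)   q = contradiction f-monic (root⇒¬monic-0 f z fz≈0)
theorem1p2 (suc m) f f-monic (z , fz≈0 , z∉ℤ) q =
  -- `B` bounds ∣x∣, and ∣y∣ ≤ ∣x∣ + K, so B + K bounds both coordinates.
  bounded⇒finite (λ (x , y) → ∏ (λ i → y + q i) ℤ.≟ evalℤ f x) (B ℕ.+ K) λ x y ∏≡fx →
    let x≤B = x-bounded x y ∏≡fx
    in ℕ.m≤n⇒m≤n+o K x≤B , ℕ.≤-trans (y≤x+K x y ∏≡fx) (ℕ.+-monoˡ-≤ K x≤B)
  where
  growth-f : Growth (suc m) (evalℤ f)
  growth-f = growth-monic (suc m) f f-monic

  f⇒∏ : ∃ λ K → ∀ x y → evalℤ f x ≡ ∏ (λ i → y + q i) → ∣ x ∣ ℕ.≤ ∣ y ∣ ℕ.+ K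
  f⇒∏ = growth⇒∣x∣≤∣y∣+K {m} growth-f (growth-∏ q)

  ∏⇒f : ∃ λ K → ∀ y x → ∏ (λ i → y + q i) ≡ evalℤ f x → ∣ y ∣ ℕ.≤ ∣ x ∣ ℕ.+ K
  ∏⇒f = growth⇒∣x∣≤∣y∣+K {m} (growth-∏ q) growth-f

  K : ℕ
  -- The growth comparison is applied in both directions; the larger constant serves for both.
  K = proj₁ f⇒∏ ℕ.⊔ proj₁ ∏⇒f

  x≤y+K : ∀ x y → ∏ (λ i → y + q i) ≡ evalℤ f x → ∣ x ∣ ℕ.≤ ∣ y ∣ ℕ.+ K
  x≤y+K x y ∏≡fx = ℕ.≤-trans (proj₂ f⇒∏ x y (sym ∏≡fx)) (ℕ.+-monoʳ-≤ ∣ y ∣ (ℕ.m≤m⊔n (proj₁ f⇒∏) (proj₁ ∏⇒f)))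

  y≤x+K : ∀ x y → ∏ (λ i → y + q i) ≡ evalℤ f x → ∣ y ∣ ℕ.≤ ∣ x ∣ ℕ.+ K
  y≤x+K x y ∏≡fx = ℕ.≤-trans (proj₂ ∏⇒f y x ∏≡fx) (ℕ.+-monoʳ-≤ ∣ x ∣ (ℕ.m≤n⊔m (proj₁ f⇒∏) (proj₁ ∏⇒f)))

  -- The equation restricted to the line y = ±x + c, as a polynomial in x alone.
  difference : Sign × ℤ → ℤ[x]
  difference (s , c) = linearProduct (s ◃ 1) (λ i → c + q i) ⊝ f

  difference-roots : ∀ sc → ∃ λ B → ∀ x → evalℤ (difference sc) x ≡ ℤ.0ℤ → ∣ x ∣ ℕ.≤ B
  difference-roots (s , c) with zero⊎roots-bounded (difference (s , c))
  ... | inj₁ d≡0     = contradiction d≡0 (root∉ℤ⇒¬IsZero f z fz≈0 z∉ℤ s (λ i → c + q i))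
  ... | inj₂ bounded = bounded

  lines : List (Sign × ℤ)
  lines = cartesianProduct signs (ball K)

  B : ℕ
  -- Only finitely many lines occur, so their root bounds have a maximum; `0` is its starting value.
  B = max 0 (map (proj₁ ∘ difference-roots) lines)

  x-bounded : ∀ x y → ∏ (λ i → y + q i) ≡ evalℤ f x → ∣ x ∣ ℕ.≤ B
  x-bounded x y ∏≡fx =
    let s , c≤K = ∣y-±x∣≤K x y (x≤y+K x y ∏≡fx) (y≤x+K x y ∏≡fx)
        sc      = s , y ℤ.- (s ◃ 1) ℤ.* x
    in ℕ.≤-trans
      -- The solution is a root on its own line, whose intercept lies in `ball K`; the root bound of
      -- that line is therefore among those maximised in `B`.
      (proj₂ (difference-roots sc) x (solution⇒root f s q x y ∏≡fx))
      (All.lookup (xs≤max 0 (map (proj₁ ∘ difference-roots) lines))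
        (∈-map⁺ (proj₁ ∘ difference-roots)
          (∈-cartesianProduct⁺ (∈-signs s) (∣i∣≤K⇒i∈ball (proj₂ sc) c≤K))))
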